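{- There are only finitely many positive integers $n$ for which $\left\lfloor n^{30}/1116 \right\rfloor$ is prime. -}

module Defs where

{-# OPTIONS --safe #-}
-- We have 1116 = 4·9·31 and n³⁰ is 0 or 1 modulo each of 8, 9 and 31, so the
-- remainder r of n³⁰ modulo 1116 is idempotent. If r = 900, which happens when
-- 6 ∣ n and 31 ∤ n, then 1116 q = n³⁰ − 30² = (n¹⁵ − 30)(n¹⁵ + 30), and both
-- factors are too large for q to be prime. Otherwise q = ⌊n³⁰/1116⌋ is
-- divisible by 2 or by 3, since n³⁰ − r is divisible by 8 or by 27.
-- For n ≥ 2 the quotient exceeds 3, so it is in fact never prime.
module Submission where

open import Defs
open import Data.List.Base using (List; [])
open import Data.List.Membership.Propositional using (_∈_)
open import Data.Nat.Base
  using (ℕ; zero; suc; 2+; _+_; _*_; _∸_; _≤_; _<_; _^_; _/_; _%_; NonZero; ≢-nonZero⁻¹)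
open import Data.Nat.Divisibility
  using (_∣_; _∣?_; divides; ∣n∣m%n⇒∣m)
open import Data.Nat.DivMod
  using (m≡m%n+[m/n]*n; m%n<n; m%n%n≡m%n; %-distribˡ-*; /-monoˡ-≤; m∣n⇒o%n%m≡o%m; m%[n*o]/o≡m/o%n)
open import Data.Nat.Primality
  using (Prime; ¬prime[0]; prime⇒nonZero; prime⇒irreducible; euclidsLemma)
open import Data.Nat.Properties
  using (_≟_; _≤?_; _<?_; allUpTo?; ≤-trans; ≤-reflexive; <-irrefl; <-≤-trans; <⇒≤; <⇒≱; *-assoc; *-comm; *-cancelˡ-≡; +-cancelˡ-≡; +-monoʳ-≤; m≤n*m; m≤m+n; m≤n+m; m+[n∸m]≡n; ^-monoˡ-≤; ^-distribˡ-+-*)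
open import Data.Nat.Solver using (module +-*-Solver)
open import Data.Product.Base using (Σ-syntax; _×_; _,_)
open import Data.Sum.Base using (_⊎_; inj₁; inj₂; map)
open import Function.Bundles using (_⇔_; mk⇔)
open import Relation.Binary.PropositionalEquality
  using (_≡_; refl; sym; trans; cong; cong₂; subst; module ≡-Reasoning)
open import Relation.Nullary.Decidable using (from-yes; _⊎-dec_)
open import Relation.Nullary.Negation using (¬_; contradiction)

^-%-reduce : ∀ m k d .{{_ : NonZero d}} → m ^ k % d ≡ (m % d) ^ k % d
^-%-reduce m zero    d = refl
^-%-reduce m (suc k) d = begin
  m * m ^ k % d                              ≡⟨ %-distribˡ-* m (m ^ k) d ⟩
  (m % d) * (m ^ k % d) % d                  ≡⟨ cong₂ (λ a b → a * b % d) (sym (m%n%n≡m%n m d)) (^-%-reduce m k d) ⟩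
  (m % d % d) * ((m % d) ^ k % d) % d        ≡⟨ %-distribˡ-* (m % d) ((m % d) ^ k) d ⟨
  (m % d) * (m % d) ^ k % d                  ∎
  where open ≡-Reasoning

m*n≡o⇒n≤o : ∀ m n {o} .{{_ : NonZero o}} → m * n ≡ o → n ≤ o
m*n≡o⇒n≤o zero    n {o} 0≡o = contradiction (sym 0≡o) (≢-nonZero⁻¹ o)
m*n≡o⇒n≤o (suc m) n     eq  = ≤-trans (m≤n*m n (suc m)) (≤-reflexive eq)

-- By Euclid's lemma `p` divides `y` or `z`. Cancelling `p` from `y * z ≡ p * k` shows that the
-- other factor divides `k`, so it is at most `k`; if that factor is `z`, then `y ≤ z` carries the
-- bound over to `y`.
prime-cofactor-bound : ∀ {p} k y z .{{_ : NonZero k}} →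
                       Prime p → y ≤ z → y * z ≡ p * k → y ≤ k
prime-cofactor-bound {p} k y z pp y≤z yz≡pk =
  bound (euclidsLemma y z pp (divides k (trans yz≡pk (*-comm p k))))
  where
  open ≡-Reasoning
  instance _ = prime⇒nonZero pp
  bound : p ∣ y ⊎ p ∣ z → y ≤ k
  bound (inj₁ (divides c y≡cp)) = ≤-trans y≤z (m*n≡o⇒n≤o c z (*-cancelˡ-≡ (c * z) k p (begin
    p * (c * z)  ≡⟨ *-assoc p c z ⟨
    p * c * z    ≡⟨ cong (_* z) (trans (*-comm p c) (sym y≡cp)) ⟩
    y * z        ≡⟨ yz≡pk ⟩
    p * k        ∎)))
  bound (inj₂ (divides c z≡cp)) = m*n≡o⇒n≤o c y (*-cancelˡ-≡ (c * y) k p (begin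
    p * (c * y)  ≡⟨ *-assoc p c y ⟨
    p * c * y    ≡⟨ cong (_* y) (trans (*-comm p c) (sym z≡cp)) ⟩
    z * y        ≡⟨ *-comm z y ⟩
    y * z        ≡⟨ yz≡pk ⟩
    p * k        ∎))

proper-divisor⇒¬prime : ∀ {d q} → 1 < d → d < q → d ∣ q → ¬ Prime q
proper-divisor⇒¬prime 1<d d<q d∣q pq with prime⇒irreducible pq d∣q
... | inj₁ refl = <-irrefl refl 1<d
... | inj₂ refl = <-irrefl refl d<q

-- The modulus 6696 = 6 · 1116 determines both n³⁰ % 1116 and ⌊n³⁰/1116⌋ % 6.
residue-cases : ∀ {r} → r < 6696 → let s = r ^ 30 % 6696 in
                2 ∣ s / 1116 ⊎ 3 ∣ s / 1116 ⊎ s % 1116 ≡ 900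
residue-cases = from-yes (allUpTo? (λ r → let s = r ^ 30 % 6696 in
  (2 ∣? s / 1116) ⊎-dec (3 ∣? s / 1116) ⊎-dec (s % 1116 ≟ 900)) 6696)

quotient-cases : ∀ n → 2 ∣ n ^ 30 / 1116 ⊎ 3 ∣ n ^ 30 / 1116 ⊎ n ^ 30 % 1116 ≡ 900
quotient-cases n = lift (n ^ 30) (subst Cases (sym (^-%-reduce n 30 6696)) (residue-cases (m%n<n n 6696)))
  where
  Cases : ℕ → Set
  Cases s = 2 ∣ s / 1116 ⊎ 3 ∣ s / 1116 ⊎ s % 1116 ≡ 900

  lift : ∀ N → Cases (N % 6696) → Cases N
  lift N = map (lift-∣ (divides 3 refl)) (map (lift-∣ (divides 2 refl))
             (trans (sym (m∣n⇒o%n%m≡o%m 1116 6696 N (divides 6 refl)))))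
    where
    -- Reducing `N` modulo 6 · 1116 before dividing by 1116 reduces the quotient modulo 6, which
    -- preserves divisibility by any divisor of 6.
    lift-∣ : ∀ {d} → d ∣ 6 → d ∣ N % 6696 / 1116 → d ∣ N / 1116
    lift-∣ {d} d∣6 d∣s = ∣n∣m%n⇒∣m d∣6 (subst (d ∣_) (m%[n*o]/o≡m/o%n N 6 1116) d∣s)

-- With x = a + y this is x² - a² = (x - a)(x + a), written additively to avoid truncated
-- subtraction.
difference-of-squares : ∀ a y → (a + y) * (a + y) ≡ a * a + y * (a + a + y)
difference-of-squares = solve 2 (λ a y → (a :+ y) :* (a :+ y) := a :* a :+ y :* (a :+ a :+ y)) refl
  where open +-*-Solver

-- Here q k = (x - a)(x + a), and the smaller factor x - a is at most `k` by `prime-cofactor-bound`.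
square-remainder⇒cofactor-bound : ∀ {q} a k x .{{_ : NonZero k}} → a ≤ x →
                                  x * x ≡ a * a + q * k → Prime q → x ≤ a + k
square-remainder⇒cofactor-bound {q} a k x a≤x xx≡ pq =
  ≤-trans (≤-reflexive (sym a+y≡x)) (+-monoʳ-≤ a y≤k)
  where
  y : ℕ
  y = x ∸ a

  a+y≡x : a + y ≡ x
  a+y≡x = m+[n∸m]≡n a≤x

  factorisation : y * (a + a + y) ≡ q * k
  factorisation = +-cancelˡ-≡ (a * a) _ _ (begin
    a * a + y * (a + a + y)  ≡⟨ difference-of-squares a y ⟨
    (a + y) * (a + y)        ≡⟨ cong₂ _*_ a+y≡x a+y≡x ⟩
    x * x                    ≡⟨ xx≡ ⟩
    a * a + q * k            ∎)
    where open ≡-Reasoning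

  y≤k : y ≤ k
  y≤k = prime-cofactor-bound k y (a + a + y) pq (m≤n+m y (a + a)) factorisation

2≤n⇒quotient-¬prime : ∀ n → 2 ≤ n → ¬ Prime (n ^ 30 / 1116)
2≤n⇒quotient-¬prime n 2≤n = by-cases (quotient-cases n)
  where
  open ≡-Reasoning
  -- The quotient is monotone in `n`, so n = 2 suffices. The bound makes 2 and 3 proper divisors
  -- whenever they divide the quotient.
  3<q : 3 < n ^ 30 / 1116
  3<q = <-≤-trans (from-yes (3 <? 2 ^ 30 / 1116)) (/-monoˡ-≤ 1116 (^-monoˡ-≤ 30 2≤n))

  by-cases : 2 ∣ n ^ 30 / 1116 ⊎ 3 ∣ n ^ 30 / 1116 ⊎ n ^ 30 % 1116 ≡ 900 → ¬ Prime (n ^ 30 / 1116)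
  by-cases (inj₁ 2∣q)        = proper-divisor⇒¬prime (from-yes (1 <? 2)) (<⇒≤ 3<q) 2∣q
  by-cases (inj₂ (inj₁ 3∣q)) = proper-divisor⇒¬prime (from-yes (1 <? 3)) 3<q 3∣q
  -- Since 900 = 30², a prime quotient would force n¹⁵ ≤ 30 + 1116 = 1146, whereas already 2¹⁵ =
  -- 32768.
  by-cases (inj₂ (inj₂ r≡900)) pq = <⇒≱ 1146<n^15
    (square-remainder⇒cofactor-bound 30 1116 (n ^ 15)
      (≤-trans (from-yes (30 ≤? 1146)) (<⇒≤ 1146<n^15)) n^30≡ pq)
    where
    1146<n^15 : 1146 < n ^ 15
    1146<n^15 = <-≤-trans (from-yes (1146 <? 2 ^ 15)) (^-monoˡ-≤ 15 2≤n)

    n^30≡ : n ^ 15 * n ^ 15 ≡ 900 + n ^ 30 / 1116 * 1116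
    n^30≡ = begin
      n ^ 15 * n ^ 15                        ≡⟨ ^-distribˡ-+-* n 15 15 ⟨
      n ^ 30                                 ≡⟨ m≡m%n+[m/n]*n (n ^ 30) 1116 ⟩
      n ^ 30 % 1116 + n ^ 30 / 1116 * 1116   ≡⟨ cong (_+ n ^ 30 / 1116 * 1116) r≡900 ⟩
      900 + n ^ 30 / 1116 * 1116             ∎

quotient-¬prime : ∀ n → ¬ Prime (n ^ 30 / 1116)
quotient-¬prime 0      = ¬prime[0]
-- `1 ^ 30 / 1116` also evaluates to 0.
quotient-¬prime 1      = ¬prime[0]
quotient-¬prime (2+ k) = 2≤n⇒quotient-¬prime (2+ k) (m≤m+n 2 k)

theorem8 : Σ[ ns ∈ List ℕ ] (∀ (n : ℕ) → n ∈ ns ⇔ (0 < n × Prime (n ^ 30 / 1116)))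
theorem8 = [] , λ n → mk⇔ (λ ()) (λ (_ , pq) → contradiction pq (quotient-¬prime n))
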